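{- For every pair of integers $r$ and $k$ with $r\ge 2$, $k$ positive, $r+k\equiv 1\pmod 2$ and $k\le r$, there exist infinitely many triples $(G,P,d)$ such that (1) $G$ is a graph with $\chi(G)\le r$, (2) $P\subset V(G)$ and $|\mathcal{D}_G(P,2)|=3(r+k-1)$, (3) $d\colon P\to[r+k]$ is a precoloring of $P$ in $G$, and (4) $d$ cannot be extended to a $\frac{3r+k+1}{2}$-coloring of $G$.
   Context: For a graph $G$, $P\subset V(G)$ and a positive integer $k$, $\mathcal{D}_G(P,k)=\{\{x,y\}\subset P: x\ne y,\ d_G(x,y)\le k\}$, where $d_G$ is the distance in $G$. $[m]=\{1,\dots,m\}$. A precoloring of $P$ in $G$ is a proper coloring of $G[P]$; an $m$-coloring of $G$ is a proper coloring using at most $m$ colors; $d$ is extended by a coloring $f$ of $G$ if $f(v)=d(v)$ for all $v\in P$. -}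

module Defs where

open import Level using (0ℓ)
open import Data.Nat using (ℕ; zero; suc; _≤_; _≟_)
open import Data.Fin using (Fin; _<_)
open import Data.Fin.Subset using (Subset; _∈_)
open import Data.List using (List; length; map; allFin; deduplicate)
open import Data.List.Membership.Propositional using () renaming (_∈_ to _∈ˡ_)
open import Data.List.Relation.Unary.Unique.Propositional using (Unique)
open import Data.Product using (_×_; _,_; ∃-syntax; Σ-syntax)
open import Function.Bundles using (_⇔_; _↔_; module Inverse)
open import Relation.Binary using (Rel; Symmetric; Irreflexive; Decidable)
open import Relation.Binary.PropositionalEquality using (_≡_; _≢_)
open import Relation.Unary using (Pred)

record Graph : Set₁ where
  field
    order  : ℕ
    Adj    : Rel (Fin order) 0ℓ
    sym    : Symmetric Adj
    irrefl : Irreflexive _≡_ Adj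
    adj?   : Decidable Adj

  V : Set
  V = Fin order

module _ (G : Graph) where
  open Graph G

  data Walk : V → V → ℕ → Set where
    here : ∀ {x} → Walk x x zero
    step : ∀ {x y z l} → Adj x y → Walk y z l → Walk x z (suc l)

  -- No δ satisfies this when x and y lie in different components
  -- (the distance is then infinite).
  IsDistance : V → V → ℕ → Set
  IsDistance x y δ = Walk x y δ × (∀ l → Walk x y l → δ ≤ l)

  Distance≤ : V → V → ℕ → Set
  Distance≤ x y k = ∃[ δ ] IsDistance x y δ × δ ≤ k

  -- The 2-subset {x , y} is represented by its increasing listing, so that
  -- every unordered pair is counted exactly once.
  𝓓 : Subset order → ℕ → Pred (V × V) 0ℓ
  𝓓 P k (x , y) = x < y × x ∈ P × y ∈ P × Distance≤ x y k

  IsProper : (V → ℕ) → Set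
  IsProper f = ∀ x y → Adj x y → f x ≢ f y

  coloursUsed : (V → ℕ) → List ℕ
  coloursUsed f = deduplicate _≟_ (map f (allFin order))

  -- Colours are arbitrary natural numbers; only the number of colours that
  -- actually occur is bounded.
  IsColouring : ℕ → (V → ℕ) → Set
  IsColouring m f = IsProper f × length (coloursUsed f) ≤ m

  Colourable : ℕ → Set
  Colourable m = ∃[ f ] IsColouring m f

  IsChromaticNumber : ℕ → Set
  IsChromaticNumber c = Colourable c × (∀ m → Colourable m → c ≤ m)

  ChromaticNumber≤ : ℕ → Set
  ChromaticNumber≤ r = ∃[ c ] IsChromaticNumber c × c ≤ r

HasCardinality : {A : Set} → Pred A 0ℓ → ℕ → Set
HasCardinality Q N =
  ∃[ xs ] Unique xs × (∀ a → (a ∈ˡ xs) ⇔ Q a) × length xs ≡ N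

-- Membership v ∈ P is a proposition, so d is a function on the vertices in P.
record Triple : Set₁ where
  field
    G : Graph
  open Graph G public
  field
    P : Subset order
    d : (v : V) → v ∈ P → ℕ

module _ (T : Triple) where
  open Triple T

  IntoRange : ℕ → Set
  IntoRange m = ∀ v (p : v ∈ P) → 1 ≤ d v p × d v p ≤ m

  -- d is a proper colouring of the induced subgraph G[P].
  IsPrecolouring : Set
  IsPrecolouring = ∀ x y (p : x ∈ P) (q : y ∈ P) → Adj x y → d x p ≢ d y q

  IsExtendedBy : (V → ℕ) → Set
  IsExtendedBy f = ∀ v (p : v ∈ P) → f v ≡ d v p

  ExtendsToColouring : ℕ → Set
  ExtendsToColouring m = ∃[ f ] IsColouring G m f × IsExtendedBy f

record _≅_ (T U : Triple) : Set where
  private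
    module T = Triple T
    module U = Triple U
  field
    bij : T.V ↔ U.V
  open Inverse bij using (to)
  field
    adj⇔ : ∀ x y → T.Adj x y ⇔ U.Adj (to x) (to y)
    ∈⇔   : ∀ v → (v ∈ T.P) ⇔ (to v ∈ U.P)
    d≡   : ∀ v (p : v ∈ T.P) (q : to v ∈ U.P) → T.d v p ≡ U.d (to v) q

-- An injective sequence of isomorphism classes.
InfinitelyMany : (Triple → Set) → Set₁
InfinitelyMany Q =
  Σ[ T ∈ (ℕ → Triple) ] (∀ i → Q (T i)) × (∀ i j → T i ≅ T j → i ≡ j)

{-# OPTIONS --safe #-}
module Submission where

-- Write n = r + k and let m = r + (n + 1) / 2 be the allowed number of colours.
-- The core of G is complete r-partite.  Its special part consists of a hub H and of three
-- precoloured vertices P of colours 1, 2, 3; the hub also has precoloured leaves Q of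
-- colours 1, 2, 3.  Part j of the other R = r − 1 parts consists of vertices U j b with
-- b ≤ B = n − 3, and the precoloured vertex S b of colour 4 + b is adjacent to U j (b + 1)
-- for every j.  The precoloured pairs at distance at most 2 are the 3 pairs PP, the 3
-- pairs QQ and the 3 (n − 3) pairs PS.  Isolated vertices make the triples pairwise
-- non-isomorphic.
--
-- In an extension, colours 1, 2, 3 occur neither on H nor on any U.  A part U j without a
-- colour outside [n] cannot be monochromatic, because of S.  Give weight 1 to the colours in
-- [n] and weight 2 to the others: the special part carries weight at least 4 and each other
-- part at least 2, all on distinct colours.  But the total weight available is only
-- n + 2 (m − n) = 2 r + 1 < 4 + 2 (r − 1).

open import Defs
open import Data.Bool using (Bool; true; false; T)
open import Data.Bool.Properties using (T?)
open import Data.Fin using (Fin; zero; suc; toℕ; fromℕ<) renaming (_<_ to _<ᶠ_)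
open import Data.Fin.Patterns using (0F; 1F; 2F)
import Data.Fin.Properties as Fin
open import Data.Fin.Permutation using (↔⇒≡)
open import Data.Fin.Subset using (_∈_)
open import Data.List using (List; []; _∷_; _++_; length; lookup; map; allFin; upTo; tabulate)
open import Data.List.Membership.Propositional using () renaming (_∈_ to _∈ˡ_)
open import Data.List.Membership.Propositional.Properties using (∈-lookup; ∈-map⁺; ∈-map⁻; ∈-++⁻; ∈-allFin; ∈-upTo⁺; ∈-tabulate⁺; ∈-tabulate⁻; ∈-deduplicate⁺; ∈-deduplicate⁻)
open import Data.List.Membership.Setoid.Properties using (index-injective)
open import Data.List.Properties using (length-++; length-map; length-upTo; length-tabulate)
open import Data.List.Relation.Binary.Subset.Propositional using (_⊆_)
open import Data.List.Relation.Unary.All using ([]; _∷_)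
import Data.List.Relation.Unary.All as All
open import Data.List.Relation.Unary.All.Properties using (¬Any⇒All¬)
open import Data.List.Relation.Unary.AllPairs using ([]; _∷_)
open import Data.List.Relation.Unary.Any using (here; there)
open import Data.List.Relation.Unary.Unique.Propositional using (Unique)
open import Data.List.Relation.Unary.Unique.Propositional.Properties using (++⁺; map⁺; tabulate⁺; allFin⁺)
open import Data.Nat using (ℕ; zero; suc; _+_; _*_; _∸_; _≤_; _<_; z≤n; s≤s)
open import Data.Nat.DivMod using (_/_; _%_; m≡m%n+[m/n]*n; m*n/n≡m)
import Data.Nat.Properties as ℕ
open import Data.List.Relation.Unary.Unique.DecPropositional.Properties ℕ._≟_ using (deduplicate-!)
open import Data.Nat.Tactic.RingSolver using (solve-∀)
open import Data.Product using (_×_; _,_; proj₁; proj₂; ∃-syntax)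
open import Data.Sum using (_⊎_; inj₁; inj₂; swap)
open import Data.Sum.Properties using (inj₁-injective; inj₂-injective)
open import Data.Sum.Function.Propositional using (_⊎-↔_)
open import Data.Unit using (tt)
import Data.Vec as Vec
open import Data.Vec.Properties using (lookup∘tabulate; []=⇒lookup; lookup⇒[]=)
open import Function using (_∘_; id)
open import Function.Bundles using (_⇔_; _↔_; mk⇔; module Inverse; module Injection; module Equivalence)
open import Function.Properties.Inverse using (↔⇒↣; ↔-sym)
open import Function.Construct.Composition using (_↔-∘_)
open import Function.Construct.Identity using (↔-id)
open import Relation.Binary.PropositionalEquality using (_≡_; _≢_; refl; sym; trans; cong; cong₂; subst; subst₂; setoid)
open import Relation.Nullary using (¬_; Dec; yes; no; contradiction)
open import Relation.Nullary.Decidable using (isYes; isNo; map′; toWitness; fromWitness; _⊎-dec_; toWitnessFalse; fromWitnessFalse)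

-- Lengths of lists without repetition.

lookup-injective : ∀ {A : Set} {xs : List A} → Unique xs →
                   ∀ i j → lookup xs i ≡ lookup xs j → i ≡ j
lookup-injective (_ ∷ _) zero zero _ = refl
lookup-injective (x≢ ∷ _) zero (suc j) eq = contradiction eq (All.lookup x≢ (∈-lookup j))
lookup-injective (x≢ ∷ _) (suc i) zero eq = contradiction (sym eq) (All.lookup x≢ (∈-lookup i))
lookup-injective (_ ∷ u) (suc i) (suc j) eq = cong suc (lookup-injective u i j eq)

-- Pigeonhole: sending a position in `xs` to the position in `ys` where the same element is found is
-- injective.
Unique-⊆⇒length≤ : ∀ {A : Set} {xs ys : List A} → Unique xs → xs ⊆ ys → length xs ≤ length ys
Unique-⊆⇒length≤ u xs⊆ys = Fin.injective⇒≤ λ {i} {j} eq →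
  lookup-injective u i j
    (index-injective (setoid _) (xs⊆ys (∈-lookup i)) (xs⊆ys (∈-lookup j)) eq)

length-Unique-Fin : ∀ {n} {xs : List (Fin n)} → Unique xs → length xs ≤ n
length-Unique-Fin u = Fin.injective⇒≤ λ {i} {j} → lookup-injective u i j

HasCardinality-tabulate : ∀ {A : Set} {Q : A → Set} {N} (f : Fin N → A) →
  (∀ {i j} → f i ≡ f j → i ≡ j) → (∀ i → Q (f i)) → (∀ a → Q a → ∃[ i ] a ≡ f i) →
  HasCardinality Q N
HasCardinality-tabulate {Q = Q} f inj sound complete =
  tabulate f , tabulate⁺ inj
  , (λ a → mk⇔ (λ a∈ → let i , a≡ = ∈-tabulate⁻ a∈ in subst Q (sym a≡) (sound i))
               (λ q → let i , a≡ = complete a q in subst (_∈ˡ tabulate f) (sym a≡) (∈-tabulate⁺ i)))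
  , length-tabulate f

-- The number of colours used by a colouring.

module _ (G : Graph) where
  open Graph G using (V; Adj; order)

  colour∈coloursUsed : ∀ f x → f x ∈ˡ coloursUsed G f
  colour∈coloursUsed f x = ∈-deduplicate⁺ ℕ._≟_ (∈-map⁺ f (∈-allFin x))

  colours≤ : ∀ {f m xs} → length (coloursUsed G f) ≤ m → Unique xs →
             (∀ {c} → c ∈ˡ xs → ∃[ x ] c ≡ f x) → length xs ≤ m
  colours≤ {f} ≤m u used = ℕ.≤-trans
    (Unique-⊆⇒length≤ u λ c∈ → let x , c≡ = used c∈ in
      subst (_∈ˡ coloursUsed G f) (sym c≡) (colour∈coloursUsed f x)) ≤m

  bounded⇒colours≤ : ∀ {f m} → (∀ x → f x < m) → length (coloursUsed G f) ≤ m
  bounded⇒colours≤ {f} {m} f< = subst (length (coloursUsed G f) ≤_) (length-upTo m)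
    (Unique-⊆⇒length≤ (deduplicate-! (map f (allFin order))) λ c∈ →
      let x , _ , c≡ = ∈-map⁻ f (∈-deduplicate⁻ ℕ._≟_ (map f (allFin order)) c∈)
      in subst (_∈ˡ upTo m) (sym c≡) (∈-upTo⁺ (f< x)))

  clique⇒≤ : ∀ {n m} (x : Fin n → V) → (∀ {i j} → i ≢ j → Adj (x i) (x j)) →
             Colourable G m → n ≤ m
  clique⇒≤ {n} {m} x clique (f , proper , ≤m) = subst (_≤ m) (length-tabulate (f ∘ x))
    (colours≤ {f} ≤m (tabulate⁺ inj) (λ c∈ → let i , c≡ = ∈-tabulate⁻ c∈ in x i , c≡))
    where
    inj : ∀ {i j} → f (x i) ≡ f (x j) → i ≡ j
    inj {i} {j} eq with i Fin.≟ j
    ... | yes i≡j = i≡j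
    ... | no  i≢j = contradiction eq (proper (x i) (x j) (clique i≢j))

∈-tabulate⇔ : ∀ {n} (f : Fin n → Bool) x → (x ∈ Vec.tabulate f) ⇔ T (f x)
∈-tabulate⇔ f x = mk⇔
  (λ x∈ → subst T (trans (sym ([]=⇒lookup x∈)) (lookup∘tabulate f x)) tt)
  (λ t → lookup⇒[]= x _ (trans (lookup∘tabulate f x) (T⇒≡ t)))
  where
  T⇒≡ : ∀ {b} → T b → b ≡ true
  T⇒≡ {true} _ = refl

-- The graph and its precolouring.

module Construction (R′ B iso : ℕ) where

  -- `R` is a successor so that the part `0F` exists; it supplies common neighbours in `middle`.
  R n order : ℕ
  R = suc R′
  n = 3 + B
  order = 3 + (3 + (B + (1 + (R * suc B + iso))))

  -- The order of the summands fixes the numbering of the vertices: every `P` precedes every `S`,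
  -- which decides how a close pair is listed increasingly.
  Vertex : Set
  Vertex = Fin 3 ⊎ (Fin 3 ⊎ (Fin B ⊎ (Fin 1 ⊎ ((Fin R × Fin (suc B)) ⊎ Fin iso))))

  pattern P a = inj₁ a
  pattern Q a = inj₂ (inj₁ a)
  pattern S b = inj₂ (inj₂ (inj₁ b))
  pattern H = inj₂ (inj₂ (inj₂ (inj₁ 0F)))
  pattern U j b = inj₂ (inj₂ (inj₂ (inj₂ (inj₁ (j , b)))))
  pattern I i = inj₂ (inj₂ (inj₂ (inj₂ (inj₂ i))))

  vertices : Fin order ↔ Vertex
  vertices = split (split (split (split ((Fin.*↔× ⊎-↔ ↔-id _) ↔-∘ Fin.+↔⊎))))
    where
    split : ∀ {m n} {A : Set} → Fin n ↔ A → Fin (m + n) ↔ (Fin m ⊎ A)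
    split f = (↔-id _ ⊎-↔ f) ↔-∘ Fin.+↔⊎

  open Inverse vertices using ()
    renaming (to to dec; from to enc; strictlyInverseˡ to dec∘enc; strictlyInverseʳ to enc∘dec)

  -- Each edge is recorded in one orientation, except that those between two parts `U` occur in
  -- both; `_~_` symmetrises. The Boolean form gives decidability, while `Edge` allows case analysis
  -- on actual edges.
  e : Vertex → Vertex → Bool
  e (P _) (U _ _) = true
  e H (U _ _) = true
  e H (Q _) = true
  e (S b) (U _ b′) = isYes (b′ Fin.≟ suc b)
  e (U j _) (U j′ _) = isNo (j Fin.≟ j′)
  e _ _ = false

  data Edge : Vertex → Vertex → Set where
    PU : ∀ {a j b} → Edge (P a) (U j b)
    HU : ∀ {j b} → Edge H (U j b)
    HQ : ∀ {a} → Edge H (Q a)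
    SU : ∀ {b j} → Edge (S b) (U j (suc b))
    UU : ∀ {j b j′ b′} → j ≢ j′ → Edge (U j b) (U j′ b′)

  edge : ∀ x y → T (e x y) → Edge x y
  edge (P a) (U j b) _ = PU
  edge H (U j b) _ = HU
  edge H (Q a) _ = HQ
  edge (S b) (U j b′) t with refl ← toWitness {a? = b′ Fin.≟ suc b} t = SU
  edge (U j b) (U j′ b′) t = UU (toWitnessFalse {a? = j Fin.≟ j′} t)

  edge⁻¹ : ∀ {x y} → Edge x y → T (e x y)
  edge⁻¹ PU = _
  edge⁻¹ HU = _
  edge⁻¹ HQ = _
  edge⁻¹ (SU {b}) = fromWitness {a? = suc b Fin.≟ suc b} refl
  edge⁻¹ (UU {j} {j′ = j′} j≢j′) = fromWitnessFalse {a? = j Fin.≟ j′} j≢j′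

  edge? : ∀ x y → Dec (Edge x y)
  edge? x y = map′ (edge x y) edge⁻¹ (T? (e x y))

  _~_ : Vertex → Vertex → Set
  x ~ y = Edge x y ⊎ Edge y x

  ~-irrefl : ∀ {x} → ¬ (x ~ x)
  ~-irrefl (inj₁ (UU j≢j)) = j≢j refl
  ~-irrefl (inj₂ (UU j≢j)) = j≢j refl

  graph : Graph
  graph = record
    { order  = order
    ; Adj    = λ x y → dec x ~ dec y
    ; sym    = swap
    ; irrefl = λ { refl → ~-irrefl }
    ; adj?   = λ x y → edge? (dec x) (dec y) ⊎-dec edge? (dec y) (dec x)
    }

  open Graph graph using (V; Adj)

  ~⇒Adj : ∀ {x y} → x ~ y → Adj (enc x) (enc y)
  ~⇒Adj = subst₂ _~_ (sym (dec∘enc _)) (sym (dec∘enc _))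

  precoloured : Vertex → Bool
  precoloured (P _) = true
  precoloured (Q _) = true
  precoloured (S _) = true
  precoloured _     = false

  colour : Vertex → ℕ
  colour (P a) = suc (toℕ a)
  colour (Q a) = suc (toℕ a)
  colour (S b) = 4 + toℕ b
  -- A default outside the precoloured set, chosen inside `[n]` so that `range` holds at every
  -- vertex.
  colour _     = 1

  triple : Triple
  triple = record
    { G = graph
    ; P = Vec.tabulate (precoloured ∘ dec)
    ; d = λ v _ → colour (dec v)
    }

  open Triple triple using () renaming (P to precolouredSet)

  ∈⇒precoloured : ∀ {x} → x ∈ precolouredSet → T (precoloured (dec x))
  ∈⇒precoloured = Equivalence.to (∈-tabulate⇔ (precoloured ∘ dec) _)

  precoloured⇒∈ : ∀ x → T (precoloured x) → enc x ∈ precolouredSet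
  precoloured⇒∈ x px = Equivalence.from (∈-tabulate⇔ (precoloured ∘ dec) _)
    (subst (T ∘ precoloured) (sym (dec∘enc x)) px)

  -- The chromatic number.

  part : Vertex → ℕ
  -- The leaves `Q` meet only `H`, which lies in class 0, so they can share the class of the part
  -- `U 0F`.
  part (Q _)   = 1
  part (U j _) = suc (toℕ j)
  part _       = 0

  part-edge : ∀ {x y} → Edge x y → part x ≢ part y
  part-edge (UU j≢j′) eq = j≢j′ (Fin.toℕ-injective (ℕ.suc-injective eq))

  part<r : ∀ x → part x < suc R
  part<r (P _)   = s≤s z≤n
  part<r (Q _)   = s≤s (s≤s z≤n)
  part<r (S _)   = s≤s z≤n
  part<r H       = s≤s z≤n
  part<r (U j _) = s≤s (Fin.toℕ<n j)
  part<r (I _)   = s≤s z≤n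

  -- One vertex from each of the `suc R` classes. `ChromaticNumber≤` asks for the exact chromatic
  -- number, hence also for a lower bound.
  clique : Fin (suc R) → Vertex
  clique zero    = H
  clique (suc j) = U j 0F

  clique-~ : ∀ {i j} → i ≢ j → clique i ~ clique j
  clique-~ {zero}  {zero}  i≢j = contradiction refl i≢j
  clique-~ {zero}  {suc j} _   = inj₁ HU
  clique-~ {suc i} {zero}  _   = inj₂ HU
  clique-~ {suc i} {suc j} i≢j = inj₁ (UU (i≢j ∘ cong suc))

  chromaticNumber : ChromaticNumber≤ graph (suc R)
  chromaticNumber = suc R
    , (( part ∘ dec
       , (λ { x y (inj₁ xy) → part-edge xy ; x y (inj₂ yx) → part-edge yx ∘ sym })
       , bounded⇒colours≤ graph (part<r ∘ dec))
      , λ m → clique⇒≤ graph (enc ∘ clique) (~⇒Adj ∘ clique-~))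
    , ℕ.≤-refl

  -- Every edge has `H` or some `U` as an end, and these are not precoloured. This makes the
  -- precolouring proper and puts distinct precoloured vertices at distance at least 2.
  precoloured-independent : ∀ {x y} → T (precoloured x) → T (precoloured y) → ¬ (x ~ y)
  precoloured-independent _ () (inj₁ PU)
  precoloured-independent () _ (inj₁ HU)
  precoloured-independent () _ (inj₁ HQ)
  precoloured-independent _ () (inj₁ SU)
  precoloured-independent _ () (inj₁ (UU _))
  precoloured-independent () _ (inj₂ PU)
  precoloured-independent _ () (inj₂ HU)
  precoloured-independent _ () (inj₂ HQ)
  precoloured-independent () _ (inj₂ SU)
  precoloured-independent _ () (inj₂ (UU _))

  isPrecolouring : IsPrecolouring triple
  isPrecolouring x y x∈ y∈ xy _ =
    precoloured-independent (∈⇒precoloured x∈) (∈⇒precoloured y∈) xy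

  intoRange : IntoRange triple n
  intoRange v _ = range (dec v)
    where
    small : ∀ (a : Fin 3) → suc (toℕ a) ≤ n
    small a = ℕ.≤-trans (Fin.toℕ<n a) (ℕ.m≤m+n 3 B)

    range : ∀ x → 1 ≤ colour x × colour x ≤ n
    range (P a)   = s≤s z≤n , small a
    range (Q a)   = s≤s z≤n , small a
    range (S b)   = s≤s z≤n , ℕ.+-monoʳ-≤ 3 (Fin.toℕ<n b)
    range H       = s≤s z≤n , s≤s z≤n
    range (U _ _) = s≤s z≤n , s≤s z≤n
    range (I _)   = s≤s z≤n , s≤s z≤n

  -- Precoloured pairs at distance at most 2.

  CloseIndex : Set
  CloseIndex = Fin 3 ⊎ (Fin 3 ⊎ (Fin 3 × Fin B))

  closeIndices : Fin (3 + (3 + 3 * B)) ↔ CloseIndex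
  closeIndices = (↔-id _ ⊎-↔ ((↔-id _ ⊎-↔ Fin.*↔×) ↔-∘ Fin.+↔⊎)) ↔-∘ Fin.+↔⊎

  -- The three 2-subsets of `Fin 3`, in the order 01, 02, 12.
  lo hi : Fin 3 → Fin 3
  lo 0F = 0F
  lo 1F = 0F
  lo 2F = 1F
  hi 0F = 1F
  hi 1F = 2F
  hi 2F = 2F

  lo-hi-injective : ∀ a b → lo a ≡ lo b → hi a ≡ hi b → a ≡ b
  lo-hi-injective 0F 0F _ _ = refl
  lo-hi-injective 1F 1F _ _ = refl
  lo-hi-injective 2F 2F _ _ = refl
  lo-hi-injective 0F 1F _ ()
  lo-hi-injective 0F 2F () _
  lo-hi-injective 1F 2F () _

  lo<hi : ∀ a → lo a <ᶠ hi a
  lo<hi 0F = s≤s z≤n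
  lo<hi 1F = s≤s z≤n
  lo<hi 2F = s≤s (s≤s z≤n)

  lo-hi-surjective : ∀ a b → a <ᶠ b → ∃[ c ] (a ≡ lo c × b ≡ hi c)
  lo-hi-surjective 0F 1F _ = 0F , refl , refl
  lo-hi-surjective 0F 2F _ = 1F , refl , refl
  lo-hi-surjective 1F 2F _ = 2F , refl , refl
  lo-hi-surjective 1F 1F (s≤s ())
  lo-hi-surjective 2F 1F (s≤s ())
  lo-hi-surjective 2F 2F (s≤s (s≤s ()))

  left right : CloseIndex → Vertex
  left (inj₁ a)               = P (lo a)
  left (inj₂ (inj₁ a))        = Q (lo a)
  left (inj₂ (inj₂ (a , _)))  = P a
  right (inj₁ a)              = P (hi a)
  right (inj₂ (inj₁ a))       = Q (hi a)
  right (inj₂ (inj₂ (_ , b))) = S b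

  middle : ∀ i → ∃[ w ] (left i ~ w × w ~ right i)
  middle (inj₁ a)              = U 0F 0F , inj₁ PU , inj₂ PU
  middle (inj₂ (inj₁ a))       = H , inj₂ HQ , inj₁ HQ
  middle (inj₂ (inj₂ (a , b))) = U 0F (suc b) , inj₁ PU , inj₂ SU

  left-precoloured : ∀ i → T (precoloured (left i))
  left-precoloured (inj₁ _)        = tt
  left-precoloured (inj₂ (inj₁ _)) = tt
  left-precoloured (inj₂ (inj₂ _)) = tt

  right-precoloured : ∀ i → T (precoloured (right i))
  right-precoloured (inj₁ _)        = tt
  right-precoloured (inj₂ (inj₁ _)) = tt
  right-precoloured (inj₂ (inj₂ _)) = tt

  left-right-injective : ∀ i j → left i ≡ left j → right i ≡ right j → i ≡ j
  left-right-injective (inj₁ a) (inj₁ b) l r =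
    cong inj₁ (lo-hi-injective a b (inj₁-injective l) (inj₁-injective r))
  left-right-injective (inj₂ (inj₁ a)) (inj₂ (inj₁ b)) l r =
    cong (inj₂ ∘ inj₁) (lo-hi-injective a b (inj₁-injective (inj₂-injective l))
                                            (inj₁-injective (inj₂-injective r)))
  left-right-injective (inj₂ (inj₂ _)) (inj₂ (inj₂ _)) refl refl = refl
  left-right-injective (inj₁ _) (inj₂ (inj₁ _)) () _
  left-right-injective (inj₁ _) (inj₂ (inj₂ _)) _ ()

  toℕ-encP : ∀ a → toℕ (enc (P a)) ≡ toℕ a
  toℕ-encP a = Fin.toℕ-↑ˡ a _

  toℕ-encQ : ∀ a → toℕ (enc (Q a)) ≡ 3 + toℕ a
  toℕ-encQ a = cong (3 +_) (Fin.toℕ-↑ˡ a _)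

  left<right : ∀ i → enc (left i) <ᶠ enc (right i)
  left<right (inj₁ a) = subst₂ _<_ (sym (toℕ-encP (lo a))) (sym (toℕ-encP (hi a))) (lo<hi a)
  left<right (inj₂ (inj₁ a)) =
    subst₂ _<_ (sym (toℕ-encQ (lo a))) (sym (toℕ-encQ (hi a))) (ℕ.+-monoʳ-< 3 (lo<hi a))
  left<right (inj₂ (inj₂ (a , b))) = subst (_< toℕ (enc (S b))) (sym (toℕ-encP a))
    (ℕ.<-≤-trans (Fin.toℕ<n a) (s≤s (s≤s (s≤s z≤n))))

  -- The middle vertex `w` decides the case. Through `H` only leaves `Q` are joined. Through a `U`
  -- only `P` and `S` are joined, and two `S` with a common neighbour `U j (suc b)` coincide, since
  -- `b` is determined. The order `S`, `P` contradicts the numbering.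
  close-complete : ∀ x y w → T (precoloured x) → T (precoloured y) → x ~ w → w ~ y →
                   enc x <ᶠ enc y → ∃[ i ] (x ≡ left i × y ≡ right i)
  close-complete (P a) (P b) _ _ _ (inj₁ PU) (inj₂ PU) x<y =
    let c , a≡ , b≡ = lo-hi-surjective a b (subst₂ _<_ (toℕ-encP a) (toℕ-encP b) x<y)
    in inj₁ c , cong inj₁ a≡ , cong inj₁ b≡
  close-complete (P a) (S b) _ _ _ (inj₁ PU) (inj₂ SU) _ = inj₂ (inj₂ (a , b)) , refl , refl
  close-complete (S b) (P a) _ _ _ (inj₁ SU) (inj₂ PU) x<y =
    contradiction (left<right (inj₂ (inj₂ (a , b)))) (ℕ.<-asym x<y)
  close-complete (S b) (S b) _ _ _ (inj₁ SU) (inj₂ SU) x<y = contradiction x<y (ℕ.<-irrefl refl)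
  close-complete (Q a) (Q b) _ _ _ (inj₂ HQ) (inj₁ HQ) x<y =
    let c , a≡ , b≡ = lo-hi-surjective a b
          (ℕ.+-cancelˡ-< 3 _ _ (subst₂ _<_ (toℕ-encQ a) (toℕ-encQ b) x<y))
    in inj₂ (inj₁ c) , cong (inj₂ ∘ inj₁) a≡ , cong (inj₂ ∘ inj₁) b≡
  close-complete (P _) (Q _) _ _ _ (inj₁ PU) (inj₁ ())
  close-complete (P _) (Q _) _ _ _ (inj₁ PU) (inj₂ ())
  close-complete (P _) (S _) _ _ _ (inj₁ PU) (inj₁ ())
  close-complete (S _) (Q _) _ _ _ (inj₁ SU) (inj₁ ())
  close-complete (S _) (Q _) _ _ _ (inj₁ SU) (inj₂ ())
  close-complete (S _) (S _) _ _ _ (inj₁ SU) (inj₁ ())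
  close-complete _ H _ _ ()
  close-complete _ (U _ _) _ _ ()
  close-complete _ (I _) _ _ ()

  walk≥2 : ∀ {x y l} → x ≢ y → x ∈ precolouredSet → y ∈ precolouredSet → Walk graph x y l → 2 ≤ l
  walk≥2 x≢y _ _ here = contradiction refl x≢y
  walk≥2 _ x∈ y∈ (step xy here) =
    contradiction xy (precoloured-independent (∈⇒precoloured x∈) (∈⇒precoloured y∈))
  walk≥2 _ _ _ (step _ (step _ _)) = s≤s (s≤s z≤n)

  enc-injective : ∀ {x y} → enc x ≡ enc y → x ≡ y
  enc-injective = Injection.injective (↔⇒↣ (↔-sym vertices))

  closePair : Fin (3 + (3 + 3 * B)) → V × V
  closePair i = enc (left (Inverse.to closeIndices i)) , enc (right (Inverse.to closeIndices i))

  closePair-injective : ∀ {i j} → closePair i ≡ closePair j → i ≡ j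
  closePair-injective eq = Injection.injective (↔⇒↣ closeIndices)
    (left-right-injective _ _ (enc-injective (cong proj₁ eq)) (enc-injective (cong proj₂ eq)))

  closePair-close : ∀ i → 𝓓 graph precolouredSet 2 (closePair i)
  closePair-close i′ = left<right i , left∈ , right∈ , 2 , (walk (middle i) , minimal) , ℕ.≤-refl
    where
    i = Inverse.to closeIndices i′
    left∈ = precoloured⇒∈ _ (left-precoloured i)
    right∈ = precoloured⇒∈ _ (right-precoloured i)

    walk : ∃[ w ] (left i ~ w × w ~ right i) → Walk graph (enc (left i)) (enc (right i)) 2
    walk (w , lw , wr) = step {y = enc w} (~⇒Adj lw) (step (~⇒Adj wr) here)

    minimal : ∀ l → Walk graph (enc (left i)) (enc (right i)) l → 2 ≤ l
    minimal l = walk≥2 (Fin.<⇒≢ (left<right i)) left∈ right∈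

  closePairs-complete : ∀ xy → 𝓓 graph precolouredSet 2 xy → ∃[ i ] xy ≡ closePair i
  closePairs-complete (x , y) (x<y , x∈ , y∈ , δ , (w , _) , δ≤2)
    -- The walk has length exactly 2: independence excludes shorter ones and `δ≤2` longer ones.
    with w | walk≥2 (Fin.<⇒≢ x<y) x∈ y∈ w | δ≤2
  ... | step {y = z} xz (step zy here) | _ | _ =
    let i , x≡ , y≡ = close-complete (dec x) (dec y) (dec z)
                        (∈⇒precoloured x∈) (∈⇒precoloured y∈) xz zy
                        (subst₂ _<ᶠ_ (sym (enc∘dec x)) (sym (enc∘dec y)) x<y)
        i≡ = Inverse.strictlyInverseˡ closeIndices i
    in Inverse.from closeIndices i
       , cong₂ _,_ (trans (sym (enc∘dec x)) (cong enc (trans x≡ (cong left (sym i≡)))))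
                   (trans (sym (enc∘dec y)) (cong enc (trans y≡ (cong right (sym i≡)))))
  ... | here | () | _
  ... | step _ here | s≤s () | _
  ... | step _ (step _ (step _ _)) | _ | s≤s (s≤s ())

  cardinality : HasCardinality (𝓓 graph precolouredSet 2) (3 + (3 + 3 * B))
  cardinality =
    HasCardinality-tabulate closePair closePair-injective closePair-close closePairs-complete

  -- Lower bound on the colours of an extension.

  module _ (g : Vertex → ℕ) (proper : ∀ {x y} → Edge x y → g x ≢ g y)
           (extends : ∀ x → T (precoloured x) → g x ≡ colour x) where

    Old : ℕ → Set
    Old c = ∃[ a ] c ≡ suc (toℕ {n} a)

    old? : ∀ c → Dec (Old c)
    old? c = Fin.any? (λ a → c ℕ.≟ suc (toℕ a))

    -- With t parts treated, the colour c does not occur on the remaining ones.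
    Fresh : ℕ → ℕ → Set
    Fresh t c = ∀ j b → t ≤ toℕ j → g (U j b) ≢ c

    -- The invariant of an induction over the parts. An entry `a` of `olds` stands for the colour
    -- `suc (toℕ a)` of `[n]`; entries of `news` lie outside `[n]`. Freshness keeps the colours of
    -- later parts distinct from those collected. Use is recorded for `news` alone because the
    -- precoloured vertices already show all of `[n]`.
    record Palette (t : ℕ) : Set where
      field
        olds         : List (Fin n)
        news         : List ℕ
        olds-unique  : Unique olds
        news-unique  : Unique news
        olds-fresh   : ∀ {a} → a ∈ˡ olds → Fresh t (suc (toℕ a))
        news-fresh   : ∀ {c} → c ∈ˡ news → Fresh t c
        news-new     : ∀ {c} → c ∈ˡ news → ¬ Old c
        news-used    : ∀ {c} → c ∈ˡ news → ∃[ x ] c ≡ g x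
        weight       : 4 + 2 * t ≤ length olds + 2 * length news

    U≢small : ∀ a j b → g (U j b) ≢ suc (toℕ {3} a)
    U≢small a j b eq = proper (PU {a}) (trans (extends (P a) tt) (sym eq))

    H≢small : ∀ a → g H ≢ suc (toℕ {3} a)
    H≢small a eq = proper (HQ {a}) (trans eq (sym (extends (Q a) tt)))

    H-fresh : Fresh 0 (g H)
    H-fresh j b _ eq = proper HU (sym eq)

    initial : Palette 0
    initial with old? (g H)
    -- The leaves `Q` keep the colour of `H` away from 1, 2, 3, so it is a fourth old colour and the
    -- weight is exactly 4.
    ... | yes (a , gH≡) = record
      { olds = a ∷ 0F ∷ 1F ∷ 2F ∷ []
      ; news = []
      ; olds-unique = ((λ { refl → H≢small 0F gH≡ }) ∷ (λ { refl → H≢small 1F gH≡ })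
                        ∷ (λ { refl → H≢small 2F gH≡ }) ∷ [])
                      ∷ ((λ ()) ∷ (λ ()) ∷ []) ∷ ((λ ()) ∷ []) ∷ [] ∷ []
      ; news-unique = []
      ; olds-fresh = λ where
          (here refl) → subst (Fresh 0) gH≡ H-fresh
          (there (here refl)) j b _ → U≢small 0F j b
          (there (there (here refl))) j b _ → U≢small 1F j b
          (there (there (there (here refl)))) j b _ → U≢small 2F j b
      ; news-fresh = λ ()
      ; news-new = λ ()
      ; news-used = λ ()
      ; weight = ℕ.≤-refl
      }
    -- Three old colours and one new colour weigh 3 + 2 = 5, one more than required.
    ... | no ¬old = record
      { olds = 0F ∷ 1F ∷ 2F ∷ []
      ; news = g H ∷ []
      ; olds-unique = ((λ ()) ∷ (λ ()) ∷ []) ∷ ((λ ()) ∷ []) ∷ [] ∷ []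
      ; news-unique = [] ∷ []
      ; olds-fresh = λ where
          (here refl) j b _ → U≢small 0F j b
          (there (here refl)) j b _ → U≢small 1F j b
          (there (there (here refl))) j b _ → U≢small 2F j b
      ; news-fresh = λ { (here refl) → H-fresh }
      ; news-new = λ { (here refl) → ¬old }
      ; news-used = λ { (here refl) → H , refl }
      ; weight = ℕ.n≤1+n 4
      }

    module _ {t} (palette : Palette t) (j : Fin R) (j≡t : toℕ j ≡ t) where
      open Palette palette

      weaken : ∀ {c} → Fresh t c → Fresh (suc t) c
      weaken fresh j′ b t<j′ = fresh j′ b (ℕ.<⇒≤ t<j′)

      -- Distinct parts are completely joined, so a colour of part `j` cannot return in a later
      -- part.
      part-fresh : ∀ b → Fresh (suc t) (g (U j b))
      part-fresh b j′ b′ t<j′ eq =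
        proper (UU {j} {b} {j′} {b′} (λ { refl → ℕ.<-irrefl (sym j≡t) t<j′ })) (sym eq)

      unseen : ∀ b {c} → Fresh t c → g (U j b) ≢ c
      unseen b fresh = fresh j b (ℕ.≤-reflexive (sym j≡t))

      weight-step : ∀ {w} → 2 + (length olds + 2 * length news) ≡ w → 4 + 2 * suc t ≤ w
      weight-step eq = subst₂ _≤_ (rearrange t) eq (ℕ.+-monoʳ-≤ 2 weight)
        where
        rearrange : ∀ t → 2 + (4 + 2 * t) ≡ 4 + 2 * suc t
        rearrange = solve-∀

      addNew : ∀ b → ¬ Old (g (U j b)) → Palette (suc t)
      addNew b ¬old = record
        { olds = olds
        ; news = g (U j b) ∷ news
        ; olds-unique = olds-unique
        ; news-unique = ¬Any⇒All¬ _ (λ c∈ → unseen b (news-fresh c∈) refl) ∷ news-unique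
        ; olds-fresh = weaken ∘ olds-fresh
        ; news-fresh = λ { (here refl) → part-fresh b ; (there c∈) → weaken (news-fresh c∈) }
        ; news-new = λ { (here refl) → ¬old ; (there c∈) → news-new c∈ }
        ; news-used = λ { (here refl) → U j b , refl ; (there c∈) → news-used c∈ }
        ; weight = weight-step (rearrange (length olds) (length news))
        }
        where
        rearrange : ∀ o w → 2 + (o + 2 * w) ≡ o + 2 * suc w
        rearrange = solve-∀

      addOlds : ∀ {b b′ a a′} → g (U j b) ≡ suc (toℕ a) → g (U j b′) ≡ suc (toℕ a′) →
                a ≢ a′ → Palette (suc t)
      addOlds {b} {b′} {a} {a′} eq eq′ a≢a′ = record
        { olds = a ∷ a′ ∷ olds
        ; news = news
        ; olds-unique = (a≢a′ ∷ ¬Any⇒All¬ _ (λ a∈ → unseen b (olds-fresh a∈) eq))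
                        ∷ ¬Any⇒All¬ _ (λ a∈ → unseen b′ (olds-fresh a∈) eq′) ∷ olds-unique
        ; news-unique = news-unique
        ; olds-fresh = λ where
            (here refl) → subst (Fresh _) eq (part-fresh b)
            (there (here refl)) → subst (Fresh _) eq′ (part-fresh b′)
            (there (there a∈)) → weaken (olds-fresh a∈)
        ; news-fresh = weaken ∘ news-fresh
        ; news-new = news-new
        ; news-used = news-used
        ; weight = weight-step refl
        }

      -- One new colour, or two different old ones, raises the weight by 2. If `U j 0F` has an old
      -- colour, adjacency to every `P` rules out 1, 2, 3, so it is the colour of some `S b`.
      addPart : Palette (suc t)
      addPart with old? (g (U j 0F))
      ... | no ¬old = addNew 0F ¬old
      ... | yes (0F , eq) = contradiction eq (U≢small 0F j 0F)
      ... | yes (1F , eq) = contradiction eq (U≢small 1F j 0F)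
      ... | yes (2F , eq) = contradiction eq (U≢small 2F j 0F)
      -- The index `3 + b` encodes the colour `4 + b` of `S b`. Its neighbour `U j (suc b)` in the
      -- same part must avoid that colour, hence brings a second colour.
      ... | yes (suc (suc (suc b)) , eq) with old? (g (U j (suc b)))
      ...   | no ¬old = addNew (suc b) ¬old
      ...   | yes (a′ , eq′) = addOlds eq eq′ λ
        { refl → proper (SU {b} {j}) (trans (extends (S b) tt) (sym eq′)) }

    paletteUpTo : ∀ t → t ≤ R → Palette t
    paletteUpTo zero    _   = initial
    paletteUpTo (suc t) t<R = addPart (paletteUpTo t (ℕ.<⇒≤ t<R)) (fromℕ< t<R) (Fin.toℕ-fromℕ< t<R)

    open Palette (paletteUpTo R ℕ.≤-refl)

    -- All `n` old colours are used, together with `news`. Since `olds` has at most `n` entries, the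
    -- weight inequality bounds `news` from below; adding `n` to both sides turns it into a bound on
    -- twice the total.
    manyColours : ∃[ cs ] Unique cs × (∀ {c} → c ∈ˡ cs → ∃[ x ] c ≡ g x)
                    × 4 + 2 * R + n ≤ 2 * length cs
    manyColours = oldColours ++ news , ++⁺ oldColours-unique news-unique disjoint , used , count
      where
      oldColours : List ℕ
      oldColours = map (suc ∘ toℕ) (allFin n)

      oldColours-unique : Unique oldColours
      oldColours-unique = map⁺ (Fin.toℕ-injective ∘ ℕ.suc-injective) (allFin⁺ n)

      disjoint : ∀ {c} → ¬ (c ∈ˡ oldColours × c ∈ˡ news)
      disjoint (c∈o , c∈n) = let a , _ , c≡ = ∈-map⁻ _ c∈o in news-new c∈n (a , c≡)

      old-used : ∀ a → ∃[ x ] suc (toℕ {n} a) ≡ g x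
      old-used 0F = P 0F , sym (extends (P 0F) tt)
      old-used 1F = P 1F , sym (extends (P 1F) tt)
      old-used 2F = P 2F , sym (extends (P 2F) tt)
      old-used (suc (suc (suc b))) = S b , sym (extends (S b) tt)

      used : ∀ {c} → c ∈ˡ oldColours ++ news → ∃[ x ] c ≡ g x
      used c∈ with ∈-++⁻ oldColours c∈
      ... | inj₁ c∈o = let a , _ , c≡ = ∈-map⁻ _ c∈o ; x , eq = old-used a in x , trans c≡ eq
      ... | inj₂ c∈n = news-used c∈n

      length-colours : length (oldColours ++ news) ≡ n + length news
      length-colours = trans (length-++ oldColours)
        (cong (_+ length news) (trans (length-map _ (allFin n)) (length-tabulate {n = n} id)))

      rearrange : ∀ n w → n + 2 * w + n ≡ 2 * (n + w)
      rearrange = solve-∀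

      count : 4 + 2 * R + n ≤ 2 * length (oldColours ++ news)
      count = begin
        4 + 2 * R + n                      ≤⟨ ℕ.+-monoˡ-≤ n weight ⟩
        length olds + 2 * length news + n  ≤⟨ ℕ.+-monoˡ-≤ n (ℕ.+-monoˡ-≤ _ (length-Unique-Fin olds-unique)) ⟩
        n + 2 * length news + n            ≡⟨ rearrange n (length news) ⟩
        2 * (n + length news)              ≡⟨ cong (2 *_) length-colours ⟨
        2 * length (oldColours ++ news)    ∎
        where open ℕ.≤-Reasoning

  extension⇒manyColours : ∀ m → ExtendsToColouring triple m → 4 + 2 * R + n ≤ 2 * m
  extension⇒manyColours m (f , (proper , ≤m) , extends) =
    let cs , unique , used , count = manyColours (f ∘ enc)
          (λ xy → proper _ _ (~⇒Adj (inj₁ xy)))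
          (λ x px → trans (extends (enc x) (precoloured⇒∈ x px)) (cong colour (dec∘enc x)))
    in ℕ.≤-trans count (ℕ.*-monoʳ-≤ 2
         (colours≤ graph {f} ≤m unique λ c∈ → let x , c≡ = used c∈ in enc x , c≡))

-- Non-isomorphism, arithmetic and conclusion.

iso-injective : ∀ R′ B i j → Construction.triple R′ B i ≅ Construction.triple R′ B j → i ≡ j
-- A bijection of vertex sets forces equal orders; cancelling the common summands leaves the numbers
-- of isolated vertices.
iso-injective R′ B i j iso = ℕ.+-cancelˡ-≡ (suc R′ * suc B) i j
  (ℕ.+-cancelˡ-≡ 1 _ _ (ℕ.+-cancelˡ-≡ B _ _ (ℕ.+-cancelˡ-≡ 6 _ _ (↔⇒≡ (_≅_.bij iso)))))

odd-sum : ∀ r k → 2 ≤ r → 1 ≤ k → (r + k) % 2 ≡ 1 → ∃[ h ] r + k ≡ 3 + 2 * h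
odd-sum r k 2≤r 1≤k odd with (r + k) / 2 | m≡m%n+[m/n]*n (r + k) 2
-- A zero quotient would give `r + k` = 1, against `r + k` ≥ 3.
... | zero  | eq = contradiction
  (subst (3 ≤_) (trans eq (cong (_+ 0) odd)) (ℕ.+-mono-≤ 2≤r 1≤k)) λ { (s≤s ()) }
... | suc h | eq = h , trans eq (trans (cong (_+ suc h * 2) odd) (rearrange h))
  where
  rearrange : ∀ h → 1 + suc h * 2 ≡ 3 + 2 * h
  rearrange = solve-∀

half : ∀ r k h → r + k ≡ 3 + 2 * h → (3 * r + k + 1) / 2 ≡ r + h + 2
half r k h eq = trans (cong (_/ 2) double) (m*n/n≡m (r + h + 2) 2)
  where
  split : ∀ r k → 3 * r + k + 1 ≡ 2 * r + 1 + (r + k)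
  split = solve-∀

  join : ∀ r h → 2 * r + 1 + (3 + 2 * h) ≡ (r + h + 2) * 2
  join = solve-∀

  double : 3 * r + k + 1 ≡ (r + h + 2) * 2
  double = trans (split r k) (trans (cong (2 * r + 1 +_) eq) (join r h))

theorem7 : (r k : ℕ) → 2 ≤ r → 1 ≤ k → (r + k) % 2 ≡ 1 → k ≤ r →
    InfinitelyMany (λ T →
    ChromaticNumber≤ (Triple.G T) r
    × HasCardinality (𝓓 (Triple.G T) (Triple.P T) 2) (3 * (r + k ∸ 1))
    × (IntoRange T (r + k) × IsPrecolouring T)
    × ¬ ExtendsToColouring T ((3 * r + k + 1) / 2))
theorem7 (suc zero) _ (s≤s ())
theorem7 r@(suc (suc R′)) k 2≤r 1≤k odd k≤r with odd-sum r k 2≤r 1≤k odd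
-- Taking `B` as `2 * h` makes `n` equal to `r + k`, and `R` is `r` minus one. The sequence runs
-- over the number of isolated vertices.
... | h , r+k≡ = triple , good , iso-injective R′ (2 * h)
  where
  open Construction R′ (2 * h)

  pairs : ∀ h → 3 + (3 + 3 * (2 * h)) ≡ 3 * (2 + 2 * h)
  pairs = solve-∀

  -- With `m` = `r + h + 2` colours allowed, the bound `4 + 2 * R + n` required of `2 * m` is
  -- exactly `2 * m + 1`: the contradiction is tight by one.
  excess : ∀ R′ h → suc (2 * (suc (suc R′) + h + 2)) ≡ 4 + 2 * suc R′ + (3 + 2 * h)
  excess = solve-∀

  good : ∀ i → ChromaticNumber≤ (graph i) r
    × HasCardinality (𝓓 (graph i) (Triple.P (triple i)) 2) (3 * (r + k ∸ 1))
    × (IntoRange (triple i) (r + k) × IsPrecolouring (triple i))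
    × ¬ ExtendsToColouring (triple i) ((3 * r + k + 1) / 2)
  good i = chromaticNumber i
    , subst (HasCardinality _) (trans (pairs h) (cong (λ n → 3 * (n ∸ 1)) (sym r+k≡))) (cardinality i)
    , (subst (IntoRange (triple i)) (sym r+k≡) (intoRange i) , isPrecolouring i)
    , λ ext → ℕ.<-irrefl refl
        (subst (_≤ 2 * (r + h + 2)) (sym (excess R′ h))
          (extension⇒manyColours i _ (subst (ExtendsToColouring (triple i)) (half r k h r+k≡) ext)))
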